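{- For every map $M$, the set of imbalances in $M$ is a class of homologous $(\bmod 2)$ cycles in the dual of $M$; that is, there is a cycle $c$ of $G_D$ such that the set of imbalances of $M$ (viewed as subsets of $SQ(M)=E(G_D)$) equals $\{c\triangle b: b\in V\}$, where $V$ is the coboundary space of $G_M$.
   Context: A map is a triple $M=(C_M,v_M,f_M)$ where $C_M$ is a finite cubic graph (multiple edges allowed) and $v_M,f_M$ are disjoint perfect matchings whose union is a disjoint union of 4-cycles, the squares ($SQ(M)$); $a_M$ is the third perfect matching. The vertices of $C_M$ are corners; $v_M(x)$, $a_M(x)$ denote the corner joined to $x$ by the corresponding edge. $G_M$ has vertices the cycles of $v_M\cup a_M$ and edges the squares (each joining the cycles containing its two $v_M$-edges); $G_D$ (graph of the dual $D=(C_M,f_M,v_M)$) has vertices the cycles of $f_M\cup a_M$ and edges the squares (each joining the cycles containing its two $f_M$-edges). A cycle is an edge set with all degrees even. Two cycles of $G_D$ are homologous if their symmetric difference is a boundary in the dual t-map, i.e. (with edge sets identified with $SQ(M)$) an element of the $GF(2)$-coboundary space $V$ of $G_M$. A balancing partition of $M$ is a partition $\{A,B\}$ of the corners such that $x$ and $v_M(x)$ are in different classes and $x$ and $a_M(v_M(x))$ are in the same class, for every corner $x$. A square is balanced if its opposite corners lie in the same class, unbalanced otherwise; an imbalance of $M$ is the set of unbalanced squares of some balancing partition. -}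

module Defs where

open import Algebra.Definitions using (Involutive)
open import Data.Bool using (if_then_else_; _xor_)
open import Data.Fin using (Fin; punchIn; punchOut; _≟_)
open import Data.Fin.Properties
  using (punchOut-cong; punchOut-injective; punchOut-punchIn; punchInᵢ≢i)
open import Data.Fin.Subset using (Subset; _∈_; _∪_; _─_)
open import Data.List using (List; []; _∷_; _++_; map; allFin)
import Data.List.Membership.Propositional as List
open import Data.List.Membership.Propositional.Properties
  using (∈-map⁺; ∈-map⁻; ∈-++⁺ˡ; ∈-++⁺ʳ; ∈-++⁻; ∈-allFin)
open import Data.List.Relation.Unary.Any using (here; there)
open import Data.Nat using (ℕ; zero; suc; _+_)
open import Data.Nat.Divisibility using (_∣_)
open import Data.Nat.Properties using (+-0-commutativeMonoid)
open import Data.Product using (∃; _×_; _,_)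
open import Data.Sum using (_⊎_; inj₁; inj₂)
open import Data.Vec using (lookup; tabulate)
open import Function using (id; _⇔_)
open import Level using (0ℓ)
open import Relation.Binary using (Rel; IsEquivalence)
open import Relation.Binary.Construct.Closure.Equivalence as Eq using (EqClosure)
open import Relation.Binary.PropositionalEquality
  using (_≡_; _≢_; refl; sym; trans; cong)
import Relation.Binary.PropositionalEquality.Properties as ≡
import Relation.Binary.Construct.On as On
open import Relation.Nullary using (¬_; yes; no; does; contradiction)

open import Algebra.Properties.CommutativeMonoid.Sum +-0-commutativeMonoid
  using (sum-syntax)

-- The classes are enumerated without repetition by Fin count.
record Quotient {n : ℕ} (_∼_ : Rel (Fin n) 0ℓ) : Set where
  field
    count     : ℕ
    class     : Fin n → Fin count
    rep       : Fin count → Fin n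
    class-rep : ∀ i → class (rep i) ≡ i
    sound     : ∀ {x y} → x ∼ y → class x ≡ class y
    complete  : ∀ {x y} → class x ≡ class y → x ∼ y

private
  Joined : ∀ {n} → List (Fin n × Fin n) → Rel (Fin n) 0ℓ
  Joined es x y = (x , y) List.∈ es

  Merged : ∀ {n} → List (Fin n × Fin n) → Rel (Fin n) 0ℓ
  Merged es = EqClosure (Joined es)

  soundBy : ∀ {n k} {R : Rel (Fin n) 0ℓ} (f : Fin n → Fin k) →
            (∀ {x y} → R x y → f x ≡ f y) →
            ∀ {x y} → EqClosure R x y → f x ≡ f y
  soundBy f = Eq.fold (On.isEquivalence f ≡.isEquivalence)

  -- Identify the distinct classes i and j, deleting the label i.
  module Identify {k : ℕ} (i j : Fin (suc k)) (i≢j : i ≢ j) where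
    relabel : Fin (suc k) → Fin k
    relabel l with i ≟ l
    ... | yes _   = punchOut i≢j
    ... | no  i≢l = punchOut i≢l

    relabel-i : relabel i ≡ relabel j
    relabel-i with i ≟ i | i ≟ j
    ... | yes _  | yes i≡j = contradiction i≡j i≢j
    ... | yes _  | no  _   = punchOut-cong i refl
    ... | no i≢i | _       = contradiction refl i≢i

    relabel-punchIn : ∀ l → relabel (punchIn i l) ≡ l
    relabel-punchIn l with i ≟ punchIn i l
    ... | yes i≡l = contradiction (sym i≡l) (punchInᵢ≢i i l)
    ... | no  i≢l = trans (punchOut-cong i refl) (punchOut-punchIn i)

    relabel-complete : ∀ l m → relabel l ≡ relabel m →
                       l ≡ m ⊎ (l ≡ i × j ≡ m) ⊎ (l ≡ j × i ≡ m)
    relabel-complete l m eq with i ≟ l | i ≟ m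
    ... | yes i≡l | yes i≡m = inj₁ (trans (sym i≡l) i≡m)
    ... | yes i≡l | no  i≢m = inj₂ (inj₁ (sym i≡l , punchOut-injective i≢j i≢m eq))
    ... | no  i≢l | yes i≡m = inj₂ (inj₂ (punchOut-injective i≢l i≢j eq , i≡m))
    ... | no  i≢l | no  i≢m = inj₁ (punchOut-injective i≢l i≢m eq)

  merge : ∀ {n} (es : List (Fin n × Fin n)) → Quotient (Merged es)
  merge {n} [] = record
    { count     = n
    ; class     = id
    ; rep       = id
    ; class-rep = λ _ → refl
    ; sound     = soundBy id λ ()
    ; complete  = λ { refl → Eq.reflexive (Joined []) }
    }
  merge {n} ((a , b) ∷ es) = go (merge es)
    where
    es⁺ = (a , b) ∷ es
    R   = Joined es⁺

    weaken : ∀ {x y} → Merged es x y → Merged es⁺ x y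
    weaken = Eq.map there

    ab : Merged es⁺ a b
    ab = Eq.return (here refl)

    go : Quotient (Merged es) → Quotient (Merged es⁺)
    go record { count = zero ; class = class } = contradiction (class a) λ ()
    go record { count = suc k ; class = class ; rep = rep ; class-rep = class-rep
              ; sound = sound ; complete = complete } with class a ≟ class b
    ... | yes a≈b = record
      { count     = suc k
      ; class     = class
      ; rep       = rep
      ; class-rep = class-rep
      ; sound     = soundBy class λ { (here refl) → a≈b
                                    ; (there xy)  → sound (Eq.return xy) }
      ; complete  = λ eq → weaken (complete eq)
      }
    ... | no a≉b = record
      { count     = k
      ; class     = λ x → relabel (class x)
      ; rep       = λ l → rep (punchIn (class a) l)
      ; class-rep = λ l → trans (cong relabel (class-rep _)) (relabel-punchIn l)
      ; sound     = soundBy (λ x → relabel (class x))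
                      λ { (here refl) → relabel-i
                        ; (there xy)  → cong relabel (sound (Eq.return xy)) }
      ; complete  = λ {x} {y} eq → join (relabel-complete (class x) (class y) eq)
      }
      where
      open Identify (class a) (class b) a≉b

      up : ∀ {x y} → class x ≡ class y → Merged es⁺ x y
      up eq = weaken (complete eq)

      join : ∀ {x y} → class x ≡ class y
                     ⊎ (class x ≡ class a × class b ≡ class y)
                     ⊎ (class x ≡ class b × class a ≡ class y) →
             Merged es⁺ x y
      join (inj₁ xy)               = up xy
      join (inj₂ (inj₁ (xa , by))) =
        Eq.transitive R (up xa) (Eq.transitive R ab (up by))
      join (inj₂ (inj₂ (xb , ay))) =
        Eq.transitive R (up xb) (Eq.transitive R (Eq.symmetric R ab) (up ay))

record PerfectMatching (n : ℕ) : Set where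
  field
    mate             : Fin n → Fin n
    mate-involutive  : Involutive _≡_ mate
    mate-irreflexive : ∀ x → mate x ≢ x

open PerfectMatching public using (mate)

module _ {n : ℕ} (p q : PerfectMatching n) where

  Adjacent : Rel (Fin n) 0ℓ
  Adjacent x y = mate p x ≡ y ⊎ mate q x ≡ y

  -- p ∪ q is 2-regular, so its components are its cycles.
  SameCycle : Rel (Fin n) 0ℓ
  SameCycle = EqClosure Adjacent

  cycles : Quotient SameCycle
  cycles = record
    { count     = count
    ; class     = class
    ; rep       = rep
    ; class-rep = class-rep
    ; sound     = λ xy → sound (Eq.map to xy)
    ; complete  = λ eq → Eq.map from (complete eq)
    }
    where
    edges : PerfectMatching n → List (Fin n × Fin n)
    edges r = map (λ x → x , mate r x) (allFin n)

    open Quotient (merge (edges p ++ edges q))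

    mate∈ : ∀ r x → (x , mate r x) List.∈ edges r
    mate∈ r x = ∈-map⁺ _ (∈-allFin x)

    ∈mate : ∀ r {x y} → (x , y) List.∈ edges r → mate r x ≡ y
    ∈mate r xy with ∈-map⁻ _ xy
    ... | _ , _ , refl = refl

    to : ∀ {x y} → Adjacent x y → (x , y) List.∈ (edges p ++ edges q)
    to (inj₁ refl) = ∈-++⁺ˡ (mate∈ p _)
    to (inj₂ refl) = ∈-++⁺ʳ (edges p) (mate∈ q _)

    from : ∀ {x y} → (x , y) List.∈ (edges p ++ edges q) → Adjacent x y
    from xy with ∈-++⁻ (edges p) xy
    ... | inj₁ e = inj₁ (∈mate p e)
    ... | inj₂ e = inj₂ (∈mate q e)

-- The order of the two ends of an edge carries no meaning.
record Graph : Set where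
  field
    #V #E     : ℕ
    end₁ end₂ : Fin #E → Fin #V

module _ (G : Graph) where
  open Graph G

  -- A loop contributes 2.
  degree : Subset #E → Fin #V → ℕ
  degree S u = ∑[ e < #E ] (if lookup S e then at (end₁ e) + at (end₂ e) else 0)
    where
    at : Fin #V → ℕ
    at w = if does (w ≟ u) then 1 else 0

  IsCycle : Subset #E → Set
  IsCycle S = ∀ u → 2 ∣ degree S u

  coboundary : Subset #V → Subset #E
  coboundary W = tabulate λ e → lookup W (end₁ e) xor lookup W (end₂ e)

  InCoboundarySpace : Subset #E → Set
  InCoboundarySpace b = ∃ λ W → b ≡ coboundary W

infixl 6 _△_

_△_ : ∀ {n} → Subset n → Subset n → Subset n
S △ T = (S ─ T) ∪ (T ─ S)

-- The cubic graph has corners Fin n as vertices, and its edge multiset is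
-- the disjoint union of the matchings v, f and a; an a-edge may be parallel to
-- a v-edge or to an f-edge. The alternating walk x, v x, f (v x), v (f (v x))
-- closes up after exactly four steps: this is the condition that v ∪ f is a
-- disjoint union of 4-cycles.
record Map : Set where
  field
    {n}        : ℕ
    v f a      : PerfectMatching n
    closes₄    : ∀ x → mate f (mate v (mate f (mate v x))) ≡ x
    not-sooner : ∀ x → mate f (mate v x) ≢ x

module _ (M : Map) where
  open Map M

  Corner : Set
  Corner = Fin n

  squares : Quotient (SameCycle v f)
  squares = cycles v f

  #SQ : ℕ
  #SQ = Quotient.count squares

  squareOf : Corner → Fin #SQ
  squareOf = Quotient.class squares

  -- With {p , q} = {v , f}: the vertices are the cycles of p ∪ a, the edges are
  -- the squares, and the two p-edges of the square of x are those at x and at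
  -- q x. Another choice of x in the square can only exchange the two ends.
  squareGraph : (p q : PerfectMatching n) → Graph
  squareGraph p q = record
    { #V   = count
    ; #E   = #SQ
    ; end₁ = λ s → class (corner s)
    ; end₂ = λ s → class (mate q (corner s))
    }
    where
    open Quotient (cycles p a) using (count; class)
    corner = Quotient.rep squares

  -- Both graphs have the same edge set Fin #SQ.
  graph dualGraph : Graph
  graph     = squareGraph v f
  dualGraph = squareGraph f v

  -- The partition {A, B} is given by A, with B its complement.
  SameClass : Subset n → Rel Corner 0ℓ
  SameClass A x y = lookup A x ≡ lookup A y

  IsBalancing : Subset n → Set
  IsBalancing A = ∀ x → ¬ SameClass A x (mate v x)
                      × SameClass A x (mate a (mate v x))

  -- The corner opposite to x in its square is f (v x).
  Balanced : Subset n → Fin #SQ → Set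
  Balanced A s = ∀ x → squareOf x ≡ s → SameClass A x (mate f (mate v x))

  IsImbalance : Subset #SQ → Set
  IsImbalance S = ∃ λ A → IsBalancing A × (∀ s → s ∈ S ⇔ (¬ Balanced A s))

{-# OPTIONS --safe #-}

-- A balancing partition is a proper 2-colouring of the cycles of v ∪ a, and two
-- of them differ by an arbitrary union of such cycles, i.e. by a set W of
-- vertices of G_M; their imbalances then differ by the coboundary of W.
-- A proper colouring exists because an alternating word of odd length in v and a
-- is a palindrome, hence conjugate to v or a, hence has no fixed point: so the
-- parity of a walk to a fixed corner of the cycle is well defined.
-- A square is unbalanced iff its f-edges are monochromatic, one in each class.
-- On a cycle of f ∪ a the matching a pairs the two classes, so both have equally
-- many corners; bichromatic f-edges use one corner of each class, hence both
-- classes contain equally many monochromatic f-edges, and their total is even.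
module Submission where

open import Defs
open import Data.Bool as Bool using (Bool; true; false; not; _xor_; if_then_else_)
open import Data.Bool.Properties
  using (not-involutive; ¬-not; not-¬; xor-same; xor-annihilates-not;
         not-distribˡ-xor)
open import Data.Bool.Solver using (module xor-∧-Solver)
open import Data.Fin using (Fin; zero; suc; _≟_)
open import Data.Fin.Permutation using (permutation)
open import Data.Fin.Subset using (Subset)
open import Data.Nat using (ℕ; zero; suc; _+_; _*_)
open import Data.Nat.Divisibility using (divides)
open import Data.Nat.Properties
  using (+-0-commutativeMonoid; +-identityʳ; +-comm; +-cancelʳ-≡; *-cancelˡ-≡)
open import Data.Nat.Solver using (module +-*-Solver)
open import Data.Product using (∃; ∃₂; _×_; _,_; proj₁; proj₂)
open import Data.Sum using (inj₁; inj₂)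
open import Data.Vec using (_∷_; lookup; tabulate)
open import Data.Vec.Properties
  using (lookup∘tabulate; tabulate∘lookup; tabulate-cong; []=⇒lookup; lookup⇒[]=)
open import Function using (_⇔_; mk⇔; Equivalence; _∘_)
import Relation.Binary.Construct.Closure.Equivalence as Eq
open import Relation.Binary.Construct.Closure.ReflexiveTransitive using (ε; _◅_)
open import Relation.Binary.Construct.Closure.Symmetric using (fwd; bwd)
open import Relation.Binary.PropositionalEquality
  using (_≡_; _≢_; refl; sym; trans; cong; cong₂; subst; module ≡-Reasoning)
import Relation.Binary.PropositionalEquality.Properties as ≡
open import Relation.Nullary using (¬_; yes; no; does; contradiction)
open import Relation.Nullary.Decidable using (dec-true; dec-false)

open import Algebra.Properties.CommutativeMonoid.Sum +-0-commutativeMonoid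
  using (sum-syntax; sum-cong-≗; sum-replicate-zero; ∑-distrib-+; ∑-comm; ∑-permute)

open PerfectMatching using (mate-involutive; mate-irreflexive)

-- Subsets as Boolean vectors, matchings and parity.

lookup-△ : ∀ {n} (S T : Subset n) i → lookup (S △ T) i ≡ lookup S i xor lookup T i
lookup-△ (true  ∷ _) (true  ∷ _) zero    = refl
lookup-△ (true  ∷ _) (false ∷ _) zero    = refl
lookup-△ (false ∷ _) (true  ∷ _) zero    = refl
lookup-△ (false ∷ _) (false ∷ _) zero    = refl
lookup-△ (_     ∷ S) (_     ∷ T) (suc i) = lookup-△ S T i

subset-ext : ∀ {n} {S T : Subset n} → (∀ i → lookup S i ≡ lookup T i) → S ≡ T
subset-ext {S = S} {T} eq =
  trans (sym (tabulate∘lookup S)) (trans (tabulate-cong eq) (tabulate∘lookup T))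

mate-swap : ∀ {n} (p : PerfectMatching n) {x y} → mate p x ≡ y → x ≡ mate p y
mate-swap p refl = sym (mate-involutive p _)

odd : ℕ → Bool
odd zero    = false
odd (suc k) = not (odd k)

-- Proper 2-colouring of the cycles of a union of two perfect matchings.

module TwoMatchings {n : ℕ} (p q : PerfectMatching n) where

  open Quotient (cycles p q)

  step : Bool → Fin n → Fin n
  step b = mate (if b then p else q)

  step-involutive : ∀ b x → step b (step b x) ≡ x
  step-involutive b = mate-involutive (if b then p else q)

  step-adjacent : ∀ b {x y} → step b x ≡ y → Adjacent p q x y
  step-adjacent true  = inj₁
  step-adjacent false = inj₂

  class-step : ∀ b x → class (step b x) ≡ class x
  class-step b x = sym (sound (Eq.return (step-adjacent b refl)))

  Alternating : (Fin n → Bool) → Set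
  Alternating A = ∀ b x → A (step b x) ≡ not (A x)

  -- A function that is constant along the edges descends to the cycles, so it can be evaluated at
  -- the representative.
  invariant-class : ∀ {ℓ} {B : Set ℓ} (g : Fin n → B) →
                    (∀ b x → g (step b x) ≡ g x) → ∀ x → g x ≡ g (rep (class x))
  invariant-class g inv x = fold (complete (sym (class-rep (class x))))
    where
    fold : ∀ {x y} → SameCycle p q x y → g x ≡ g y
    fold = Eq.gfold ≡.isEquivalence g λ
      { (inj₁ refl) → sym (inv true _) ; (inj₂ refl) → sym (inv false _) }

  alt : Bool → ℕ → Fin n → Fin n
  alt c zero    x = x
  alt c (suc k) x = alt (not c) k (step c x)

  -- The recursion of `alt` exposes the letter that acts first; this exposes the one that acts last,
  -- which is `c` exactly when `k` is even.
  alt-last : ∀ c k x → alt c (suc k) x ≡ step (c xor odd k) (alt c k x)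
  alt-last true  zero    x = refl
  alt-last false zero    x = refl
  alt-last true  (suc k) x with alt-last false k (step true x)
  ... | eq rewrite not-involutive (odd k) = eq
  alt-last false (suc k) x = alt-last true k (step false x)

  -- The first and last letters of an odd word agree, so a fixed point `x` of the word gives the
  -- fixed point `step c x` of the word without them. The descent ends at a single letter, and a
  -- matching fixes no corner.
  alt-odd-irreflexive : ∀ c k x → odd k ≡ true → alt c k x ≢ x
  alt-odd-irreflexive c (suc zero)    x _ = mate-irreflexive (if c then p else q) x
  alt-odd-irreflexive c (suc (suc k)) x o eq =
    alt-odd-irreflexive (not c) k (step c x) odd-k
      (trans (sym (step-involutive c _)) (cong (step c) ends))
    where
    odd-k : odd k ≡ true
    odd-k = trans (sym (not-involutive (odd k))) o

    letter : ∀ c → not c xor true ≡ c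
    letter true  = refl
    letter false = refl

    ends : step c (alt (not c) k (step c x)) ≡ x
    ends = begin
      step c (alt (not c) k (step c x))
        ≡⟨ cong (λ b → step b (alt (not c) k (step c x)))
                (trans (sym (letter c)) (cong (not c xor_) (sym odd-k))) ⟩
      step (not c xor odd k) (alt (not c) k (step c x))
        ≡⟨ alt-last (not c) k (step c x) ⟨
      alt c (suc (suc k)) x
        ≡⟨ eq ⟩
      x ∎
      where open ≡-Reasoning

  -- Only reduced words occur, in which no letter follows itself. For `k = 0` the letter `c` carries
  -- no information.
  Walk : Bool → Fin n → Fin n → Set
  Walk o x y = ∃₂ λ c k → odd k ≡ o × alt c k x ≡ y

  -- The new letter either extends the word or cancels against an equal first letter. The length
  -- changes by one in both cases, so the parity flips.
  walk-∷ : ∀ b {o x y} → Walk o (step b x) y → Walk (not o) x y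
  walk-∷ b (c , zero , refl , eq) = b , 1 , refl , eq
  walk-∷ b {x = x} (c , suc k , refl , eq) with c Bool.≟ b
  ... | yes refl = not b , k , sym (not-involutive (odd k))
                 , trans (cong (alt (not b) k) (sym (step-involutive b x))) eq
  ... | no  c≢b  = b , suc (suc k) , refl
                 , trans (cong (λ d → alt d (suc k) (step b x)) (sym (¬-not c≢b))) eq

  walk-∷⁻ : ∀ b {o x y} → Walk o x y → Walk (not o) (step b x) y
  walk-∷⁻ b {x = x} w = walk-∷ b (subst (λ z → Walk _ z _) (sym (step-involutive b x)) w)

  -- The letters of the given word are moved one at a time onto the other walk, flipping both
  -- parities. What remains is a closed walk, which cannot be odd.
  walk-parity : ∀ c k {o x y} → alt c k x ≡ y → Walk o x y → odd k ≡ o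
  walk-parity _ zero {x = x} refl (c , k , refl , eq) with odd k in o
  ... | true  = contradiction eq (alt-odd-irreflexive c k x o)
  ... | false = refl
  walk-parity c (suc k) eq w =
    trans (cong not (walk-parity (not c) k eq (walk-∷⁻ c w))) (not-involutive _)

  walk-parity-unique : ∀ {o o′ x y} → Walk o x y → Walk o′ x y → o ≡ o′
  walk-parity-unique (c , k , refl , eq) = walk-parity c k eq

  walk : ∀ {x y} → SameCycle p q x y → ∃ λ o → Walk o x y
  walk ε                       = _ , true , 0 , refl , refl
  walk (fwd (inj₁ refl) ◅ xy)  = _ , walk-∷ true  (proj₂ (walk xy))
  walk (fwd (inj₂ refl) ◅ xy)  = _ , walk-∷ false (proj₂ (walk xy))
  walk (bwd (inj₁ refl) ◅ xy)  = _ , walk-∷⁻ true  (proj₂ (walk xy))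
  walk (bwd (inj₂ refl) ◅ xy)  = _ , walk-∷⁻ false (proj₂ (walk xy))

  walk-to-rep : ∀ x → ∃ λ o → Walk o x (rep (class x))
  walk-to-rep x = walk (complete (sym (class-rep (class x))))

  colour : Fin n → Bool
  colour x = proj₁ (walk-to-rep x)

  -- Prepending one step to the walk chosen at `x` gives a walk from its neighbour to the same
  -- representative, of opposite parity; the walk chosen at the neighbour must share that parity.
  colour-alternating : Alternating colour
  colour-alternating b x = walk-parity-unique
    (subst (Walk _ _) (cong rep (class-step b x)) (proj₂ (walk-to-rep (step b x))))
    (walk-∷⁻ b (proj₂ (walk-to-rep x)))

-- Finite sums, and the weights on a single square.

∑-select : ∀ {m} (i : Fin m) (t : Fin m → ℕ) →
           ∑[ e < m ] (if does (i ≟ e) then t e else 0) ≡ t i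
∑-select {suc m} zero    t =
  trans (cong (t zero +_) (sum-replicate-zero m)) (+-identityʳ (t zero))
∑-select         (suc i) t = ∑-select i (t ∘ suc)

∑-fibres : ∀ {m n} (h : Fin n → Fin m) (g : Fin n → ℕ) →
           ∑[ x < n ] g x ≡ ∑[ e < m ] ∑[ x < n ] (if does (h x ≟ e) then g x else 0)
∑-fibres h g = trans
  (sum-cong-≗ λ x → sym (∑-select (h x) (λ _ → g x)))
  (∑-comm λ x e → if does (h x ≟ e) then g x else 0)

double-injective : ∀ {k l} → k + k ≡ l + l → k ≡ l
double-injective {k} {l} eq = *-cancelˡ-≡ k l 2 (trans (double k) (trans eq (sym (double l))))
  where
  double : ∀ j → 2 * j ≡ j + j
  double j = cong (j +_) (+-identityʳ j)

-- p, q are the colours of the ends of one f-edge of a square, whose other f-edge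
-- has ends of colours not p, not q; k and l are the weights of the two f-edges.
mono bi : Bool → Bool → ℕ → ℕ → ℕ
mono p q k l = if p xor not q then (if p then k else l) else 0
bi   p q k l = if p xor q then k + l else 0

-- The left side runs over the corners `y`, `v y`, `f y`, `f (v y)`. A monochromatic f-edge of
-- colour `true` counts with both ends, a bichromatic one with one end.
coloured-weight : ∀ p q k l →
  (if p then k else 0) + ((if not p then l else 0) +
    ((if q then k else 0) + (if not q then l else 0)))
  ≡ mono p q k l + mono p q k l + bi p q k l
coloured-weight true  true  k l = solve 1 (λ k → k :+ (k :+ con 0) := k :+ k :+ con 0) refl k
  where open +-*-Solver
coloured-weight true  false k l = refl
coloured-weight false true  k l = trans (cong (l +_) (+-identityʳ k)) (+-comm l k)
coloured-weight false false k l = sym (+-identityʳ (l + l))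

-- When `p` and `q` agree, one f-edge is monochromatic in each colour, so each of `k` and `l`
-- appears once on the right.
mono-split : ∀ p q k l →
  (if p xor not q then k + l else 0) ≡ mono p q k l + mono (not p) (not q) k l
mono-split true  true  k l = refl
mono-split true  false k l = refl
mono-split false true  k l = refl
mono-split false false k l = +-comm k l

bi-not : ∀ p q k l → bi (not p) (not q) k l ≡ bi p q k l
bi-not p q k l = cong (if_then k + l else 0) (xor-annihilates-not p q)

module Imbalances (M : Map) where

  open Map M
  open Quotient (squares M) using () renaming
    (rep to corner; class-rep to squareOf-corner; sound to squareOf-sound;
     complete to squareOf-complete)
  open TwoMatchings v a using (Alternating; class-step; invariant-class)
  open Quotient (cycles v a) using () renaming (class to vertex; rep to rep-vertex)

  -- The four corners of a square.

  vfv≡f : ∀ x → mate v (mate f (mate v x)) ≡ mate f x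
  vfv≡f x = mate-swap f (closes₄ x)

  fv≡vf : ∀ x → mate f (mate v x) ≡ mate v (mate f x)
  fv≡vf x = mate-swap v (vfv≡f x)

  -- Positions relative to `y`: matching on them replaces the equivalence closure by four cases.
  data InSquare (y : Fin n) : Fin n → Set where
    at-y   : InSquare y y
    at-vy  : InSquare y (mate v y)
    at-fy  : InSquare y (mate f y)
    at-fvy : InSquare y (mate f (mate v y))

  inSquare-v : ∀ {y x} → InSquare y x → InSquare y (mate v x)
  inSquare-v {y} at-y   = at-vy
  inSquare-v {y} at-vy  = subst (InSquare y) (sym (mate-involutive v y)) at-y
  inSquare-v {y} at-fy  = subst (InSquare y) (fv≡vf y) at-fvy
  inSquare-v {y} at-fvy = subst (InSquare y) (sym (vfv≡f y)) at-fy

  inSquare-f : ∀ {y x} → InSquare y x → InSquare y (mate f x)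
  inSquare-f {y} at-y   = at-fy
  inSquare-f {y} at-vy  = at-fvy
  inSquare-f {y} at-fy  = subst (InSquare y) (sym (mate-involutive f y)) at-y
  inSquare-f {y} at-fvy = subst (InSquare y) (sym (mate-involutive f (mate v y))) at-vy

  -- The four positions are closed under `v` and `f`, hence fill the component of `y`. A backward
  -- edge is a forward one, since matchings are involutive.
  sameCycle⇒inSquare : ∀ {y x z} → InSquare y x → SameCycle v f x z → InSquare y z
  sameCycle⇒inSquare s ε = s
  sameCycle⇒inSquare s (fwd (inj₁ refl) ◅ c) = sameCycle⇒inSquare (inSquare-v s) c
  sameCycle⇒inSquare s (fwd (inj₂ refl) ◅ c) = sameCycle⇒inSquare (inSquare-f s) c
  sameCycle⇒inSquare {y} s (bwd (inj₁ e) ◅ c) =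
    sameCycle⇒inSquare (subst (InSquare y) (sym (mate-swap v e)) (inSquare-v s)) c
  sameCycle⇒inSquare {y} s (bwd (inj₂ e) ◅ c) =
    sameCycle⇒inSquare (subst (InSquare y) (sym (mate-swap f e)) (inSquare-f s)) c

  squareOf-v : ∀ x → squareOf M (mate v x) ≡ squareOf M x
  squareOf-v x = sym (squareOf-sound (Eq.return (inj₁ refl)))

  squareOf-f : ∀ x → squareOf M (mate f x) ≡ squareOf M x
  squareOf-f x = sym (squareOf-sound (Eq.return (inj₂ refl)))

  inSquare⇒squareOf : ∀ {y x} → InSquare y x → squareOf M x ≡ squareOf M y
  inSquare⇒squareOf at-y   = refl
  inSquare⇒squareOf at-vy  = squareOf-v _
  inSquare⇒squareOf at-fy  = squareOf-f _
  inSquare⇒squareOf at-fvy = trans (squareOf-f _) (squareOf-v _)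

  f≢v : ∀ x → mate f x ≢ mate v x
  f≢v x eq = not-sooner x (sym (mate-swap f eq))

  fv≢f : ∀ x → mate f (mate v x) ≢ mate f x
  fv≢f x eq = mate-irreflexive v x
    (trans (mate-swap f eq) (mate-involutive f x))

  -- Summing over corners square by square.

  squareSum : (Fin n → ℕ) → Fin n → ℕ
  squareSum h y = h y + (h (mate v y) + (h (mate f y) + h (mate f (mate v y))))

  module _ (g : Fin n → ℕ) where

    private
      δ : Fin n → Fin n → ℕ
      δ i x = if does (i ≟ x) then g x else 0

      δ-hit : ∀ x → δ x x ≡ g x
      δ-hit x rewrite dec-true (x ≟ x) refl = refl

      δ-miss : ∀ {i x} → i ≢ x → δ i x ≡ 0
      δ-miss {i} {x} i≢x rewrite dec-false (i ≟ x) i≢x = refl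

      -- The four corners are distinct, so exactly one of the four point masses survives.
      squareSum-δ : ∀ {y x} → InSquare y x → squareSum (λ i → δ i x) y ≡ g x
      squareSum-δ {y} at-y
        rewrite δ-hit y
              | δ-miss (mate-irreflexive v y) | δ-miss (mate-irreflexive f y)
              | δ-miss (not-sooner y) = +-identityʳ (g y)
      squareSum-δ {y} at-vy
        rewrite δ-miss (mate-irreflexive v y ∘ sym) | δ-hit (mate v y)
              | δ-miss (f≢v y) | δ-miss (mate-irreflexive f (mate v y))
        = +-identityʳ (g (mate v y))
      squareSum-δ {y} at-fy
        rewrite δ-miss (mate-irreflexive f y ∘ sym) | δ-miss (f≢v y ∘ sym)
              | δ-hit (mate f y) | δ-miss (fv≢f y) = +-identityʳ (g (mate f y))
      squareSum-δ {y} at-fvy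
        rewrite δ-miss (not-sooner y ∘ sym)
              | δ-miss (mate-irreflexive f (mate v y) ∘ sym)
              | δ-miss (fv≢f y ∘ sym) = δ-hit (mate f (mate v y))

      squareSum-δ-outside : ∀ {y x} → ¬ InSquare y x → squareSum (λ i → δ i x) y ≡ 0
      squareSum-δ-outside {y} {x} ∉
        rewrite δ-miss {y} {x} (λ { refl → ∉ at-y })
              | δ-miss {mate v y} {x} (λ { refl → ∉ at-vy })
              | δ-miss {mate f y} {x} (λ { refl → ∉ at-fy })
              | δ-miss {mate f (mate v y)} {x} (λ { refl → ∉ at-fvy }) = refl

      -- The indicator of a square is the sum of the point masses at its four corners.
      fibre : ∀ s x → (if does (squareOf M x ≟ s) then g x else 0)
                      ≡ squareSum (λ i → δ i x) (corner s)
      fibre s x with squareOf M x ≟ s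
      ... | yes eq = sym (squareSum-δ (sameCycle⇒inSquare at-y
                       (squareOf-complete (trans (squareOf-corner s) (sym eq)))))
      ... | no neq = sym (squareSum-δ-outside λ i →
                       neq (trans (inSquare⇒squareOf i) (squareOf-corner s)))

      ∑-squareSum-δ : ∀ y → ∑[ x < n ] squareSum (λ i → δ i x) y ≡ squareSum g y
      ∑-squareSum-δ y = begin
        ∑[ x < n ] squareSum (λ i → δ i x) y
          ≡⟨ ∑-distrib-+ (δ y) _ ⟩
        ∑δ y + ∑[ x < n ] (δ (mate v y) x + (δ (mate f y) x + δ (mate f (mate v y)) x))
          ≡⟨ cong (∑δ y +_) (∑-distrib-+ (δ (mate v y)) _) ⟩
        ∑δ y + (∑δ (mate v y) + ∑[ x < n ] (δ (mate f y) x + δ (mate f (mate v y)) x))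
          ≡⟨ cong (λ t → ∑δ y + (∑δ (mate v y) + t)) (∑-distrib-+ (δ (mate f y)) _) ⟩
        squareSum ∑δ y
          ≡⟨ cong₂ _+_ (∑-select y g) (cong₂ _+_ (∑-select (mate v y) g)
               (cong₂ _+_ (∑-select (mate f y) g) (∑-select (mate f (mate v y)) g))) ⟩
        squareSum g y ∎
        where
        open ≡-Reasoning
        ∑δ : Fin n → ℕ
        ∑δ i = ∑[ x < n ] δ i x

    ∑-squares : ∑[ x < n ] g x ≡ ∑[ s < #SQ M ] squareSum g (corner s)
    ∑-squares = trans (∑-fibres (squareOf M) g)
      (sum-cong-≗ λ s → trans (sum-cong-≗ (fibre s)) (∑-squareSum-δ (corner s)))

  -- The imbalance of a colouring is a cycle of the dual graph.

  unbalanced : (Fin n → Bool) → Fin n → Bool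
  unbalanced A x = A x xor A (mate f (mate v x))

  imbalance : (Fin n → Bool) → Subset (#SQ M)
  imbalance A = tabulate (unbalanced A ∘ corner)

  module _ {A : Fin n → Bool} (alternating : Alternating A) where

    A-fv : ∀ x → A (mate f (mate v x)) ≡ not (A (mate f x))
    A-fv x = trans (cong A (fv≡vf x)) (alternating true (mate f x))

    unbalanced-v : ∀ x → unbalanced A (mate v x) ≡ unbalanced A x
    unbalanced-v x = begin
      A (mate v x) xor A (mate f (mate v (mate v x)))
        ≡⟨ cong₂ _xor_ (alternating true x) (A-fv (mate v x)) ⟩
      not (A x) xor not (A (mate f (mate v x)))
        ≡⟨ xor-annihilates-not (A x) _ ⟩
      unbalanced A x ∎
      where open ≡-Reasoning

    unbalanced-f : ∀ x → unbalanced A (mate f x) ≡ unbalanced A x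
    unbalanced-f x = begin
      A (mate f x) xor A (mate f (mate v (mate f x)))
        ≡⟨ cong (A (mate f x) xor_) (A-fv (mate f x)) ⟩
      A (mate f x) xor not (A (mate f (mate f x)))
        ≡⟨ cong (λ z → A (mate f x) xor not (A z)) (mate-involutive f x) ⟩
      A (mate f x) xor not (A x)
        -- `not p` unfolds to `true xor p`, so the identity is linear over GF(2).
        ≡⟨ solve 2 (λ p q → q :+ (con true :+ p) := p :+ (con true :+ q)) refl
                 (A x) (A (mate f x)) ⟩
      A x xor not (A (mate f x))
        ≡⟨ cong (A x xor_) (A-fv x) ⟨
      unbalanced A x ∎
      where
      open ≡-Reasoning
      open xor-∧-Solver

    -- Moving along `v` or `f` preserves the value, so it belongs to the square and the chosen
    -- corner decides it.
    unbalanced-corner : ∀ x → unbalanced A x ≡ unbalanced A (corner (squareOf M x))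
    unbalanced-corner = TwoMatchings.invariant-class v f (unbalanced A) λ
      { true → unbalanced-v ; false → unbalanced-f }

    imbalance-isCycle : IsCycle (dualGraph M) (imbalance A)
    -- `T` counts the ends at `u` of unbalanced squares whose f-edge there is monochromatic of
    -- colour `true`; colour `false` gives the same number.
    imbalance-isCycle u = divides T (begin
      degree (dualGraph M) (imbalance A) u
        ≡⟨ sum-cong-≗ edge-degree ⟩
      ∑[ s < #SQ M ] (α s + β s)
        ≡⟨ ∑-distrib-+ α β ⟩
      ∑[ s < #SQ M ] α s + ∑[ s < #SQ M ] β s
        ≡⟨ cong (T +_) (sym ∑α≡∑β) ⟩
      T + T
        ≡⟨ solve 1 (λ t → t :+ t := t :* con 2) refl T ⟩
      T * 2 ∎)
      where
      open ≡-Reasoning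
      open +-*-Solver
      open Quotient (cycles f a) using () renaming (class to face; sound to face-sound)

      χ : Fin n → ℕ
      χ x = if does (face x ≟ u) then 1 else 0

      -- Both ends of an f-edge lie on one face, so the edge has a single weight.
      χ-f : ∀ x → χ (mate f x) ≡ χ x
      χ-f x = cong (λ i → if does (i ≟ u) then 1 else 0)
                   (sym (face-sound (Eq.return (inj₁ refl))))

      χ-a : ∀ x → χ (mate a x) ≡ χ x
      χ-a x = cong (λ i → if does (i ≟ u) then 1 else 0)
                   (sym (face-sound (Eq.return (inj₂ refl))))

      μ ν : (Fin n → Bool) → Fin (#SQ M) → ℕ
      μ B s = let y = corner s in mono (B y) (B (mate f y)) (χ y) (χ (mate v y))
      ν B s = let y = corner s in bi (B y) (B (mate f y)) (χ y) (χ (mate v y))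

      α β : Fin (#SQ M) → ℕ
      α = μ A
      β = μ (not ∘ A)

      T : ℕ
      T = ∑[ s < #SQ M ] α s

      edge-degree : ∀ s → (if lookup (imbalance A) s
                           then χ (corner s) + χ (mate v (corner s)) else 0) ≡ α s + β s
      edge-degree s = trans
        (cong (if_then χ y + χ (mate v y) else 0)
              (trans (lookup∘tabulate _ s) (cong (A y xor_) (A-fv y))))
        (mono-split (A y) (A (mate f y)) (χ y) (χ (mate v y)))
        where y = corner s

      inside : (Fin n → Bool) → Fin n → ℕ
      inside B x = if B x then χ x else 0

      -- Reindexing along `mate a` stays within each face and exchanges the colours.
      ∑inside : (∑[ x < n ] inside A x) ≡ (∑[ x < n ] inside (not ∘ A) x)
      ∑inside = trans
        (∑-permute (inside A)
          (permutation (mate a) (mate a) (mate-involutive a) (mate-involutive a)))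
        (sum-cong-≗ λ x → cong₂ (λ b k → if b then k else 0) (alternating false x) (χ-a x))

      squareSum-inside : ∀ {B} → Alternating B → ∀ s →
                         squareSum (inside B) (corner s) ≡ μ B s + μ B s + ν B s
      squareSum-inside {B} alt s = trans
        (cong (inside B y +_) (cong₂ _+_
          (cong (if_then χ (mate v y) else 0) (alt true y))
          (cong₂ _+_
            (cong (if B (mate f y) then_else 0) (χ-f y))
            (cong₂ (λ b k → if b then k else 0)
              (trans (cong B (fv≡vf y)) (alt true (mate f y))) (χ-f (mate v y))))))
        (coloured-weight (B y) (B (mate f y)) _ _)
        where y = corner s

      ∑inside-squares : ∀ {B} → Alternating B →
        (∑[ x < n ] inside B x)
        ≡ (∑[ s < #SQ M ] μ B s) + (∑[ s < #SQ M ] μ B s) + (∑[ s < #SQ M ] ν B s)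
      ∑inside-squares {B} alt = begin
        ∑[ x < n ] inside B x
          ≡⟨ ∑-squares (inside B) ⟩
        ∑[ s < #SQ M ] squareSum (inside B) (corner s)
          ≡⟨ sum-cong-≗ (squareSum-inside alt) ⟩
        ∑[ s < #SQ M ] (μ B s + μ B s + ν B s)
          ≡⟨ ∑-distrib-+ (λ s → μ B s + μ B s) (ν B) ⟩
        (∑[ s < #SQ M ] (μ B s + μ B s)) + (∑[ s < #SQ M ] ν B s)
          ≡⟨ cong (_+ (∑[ s < #SQ M ] ν B s)) (∑-distrib-+ (μ B) (μ B)) ⟩
        (∑[ s < #SQ M ] μ B s) + (∑[ s < #SQ M ] μ B s) + (∑[ s < #SQ M ] ν B s) ∎

      -- Both colours have the same total weight at `u` and the same bichromatic share; cancelling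
      -- that share leaves twice each monochromatic sum.
      ∑α≡∑β : (∑[ s < #SQ M ] α s) ≡ (∑[ s < #SQ M ] β s)
      ∑α≡∑β = double-injective (+-cancelʳ-≡ (∑[ s < #SQ M ] ν A s) _ _ (begin
        T + T + (∑[ s < #SQ M ] ν A s)
          ≡⟨ ∑inside-squares alternating ⟨
        ∑[ x < n ] inside A x
          ≡⟨ ∑inside ⟩
        ∑[ x < n ] inside (not ∘ A) x
          ≡⟨ ∑inside-squares (λ b x → cong not (alternating b x)) ⟩
        (∑[ s < #SQ M ] β s) + (∑[ s < #SQ M ] β s) + (∑[ s < #SQ M ] ν (not ∘ A) s)
          ≡⟨ cong ((∑[ s < #SQ M ] β s) + (∑[ s < #SQ M ] β s) +_)
                  (sum-cong-≗ λ s → bi-not (A (corner s)) _ (χ (corner s)) (χ (mate v (corner s)))) ⟩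
        (∑[ s < #SQ M ] β s) + (∑[ s < #SQ M ] β s) + (∑[ s < #SQ M ] ν A s) ∎))

  -- Balancing partitions as alternating colourings.

  isBalancing⇒alternating : ∀ {A} → IsBalancing M A → Alternating (lookup A)
  isBalancing⇒alternating {A} bal true x = ¬-not (proj₁ (bal x) ∘ sym)
  -- The same-class condition is used at `mate v x`, where it relates `mate v x` to `mate a x`.
  isBalancing⇒alternating {A} bal false x = begin
    lookup A (mate a x)
      ≡⟨ cong (lookup A ∘ mate a) (mate-involutive v x) ⟨
    lookup A (mate a (mate v (mate v x)))
      ≡⟨ proj₂ (bal (mate v x)) ⟨
    lookup A (mate v x)
      ≡⟨ isBalancing⇒alternating {A} bal true x ⟩
    not (lookup A x) ∎
    where open ≡-Reasoning

  alternating⇒isBalancing : ∀ {A} → Alternating A → IsBalancing M (tabulate A)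
  alternating⇒isBalancing {A} alt x
    rewrite lookup∘tabulate A x | lookup∘tabulate A (mate v x)
          | lookup∘tabulate A (mate a (mate v x))
    = (λ eq → not-¬ (sym eq) (alt true x))
    , sym (trans (alt false (mate v x))
                 (trans (cong not (alt true x)) (not-involutive (A x))))

  alternating-resp-≗ : ∀ {A B} → (∀ x → A x ≡ B x) → Alternating A → Alternating B
  alternating-resp-≗ eq alt b x =
    trans (sym (eq _)) (trans (alt b x) (cong not (eq x)))

  xor≡false⇒≡ : ∀ p q → p xor q ≡ false → p ≡ q
  xor≡false⇒≡ true  true  _ = refl
  xor≡false⇒≡ false false _ = refl

  -- `Balanced` ranges over all corners of the square; by `unbalanced-corner` a single one suffices,
  -- which makes the condition Boolean.
  balanced⇔ : ∀ A → Alternating (lookup A) → ∀ s →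
              Balanced M A s ⇔ unbalanced (lookup A) (corner s) ≡ false
  balanced⇔ A alt s = mk⇔
    (λ bal → trans (cong (lookup A (corner s) xor_) (sym (bal _ (squareOf-corner s))))
                   (xor-same (lookup A (corner s))))
    (λ { eq x refl → xor≡false⇒≡ _ _ (trans (unbalanced-corner {lookup A} alt x) eq) })

  isImbalance⇒ : ∀ {S} → IsImbalance M S →
                 ∃ λ A → Alternating A × S ≡ imbalance A
  isImbalance⇒ {S} (A , bal , mem) = lookup A , alt , subset-ext λ s →
    trans (agree s _ refl) (sym (lookup∘tabulate _ s))
    where
    alt = isBalancing⇒alternating {A} bal

    -- The Boolean value is a separate argument so that the negated condition can be settled by
    -- cases.
    agree : ∀ s b → unbalanced (lookup A) (corner s) ≡ b →
            lookup S s ≡ unbalanced (lookup A) (corner s)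
    agree s true eq = trans ([]=⇒lookup (Equivalence.from (mem s) λ balanced →
      not-¬ (Equivalence.to (balanced⇔ A alt s) balanced) eq)) (sym eq)
    agree s false eq = trans (¬-not λ s∈S →
      Equivalence.to (mem s) (lookup⇒[]= s S s∈S) (Equivalence.from (balanced⇔ A alt s) eq))
      (sym eq)

  ⇒isImbalance : ∀ {A} → Alternating A → IsImbalance M (imbalance A)
  ⇒isImbalance {A} alt = tabulate A , alternating⇒isBalancing alt , λ s → mk⇔
    (λ s∈S balanced → not-¬
      (trans (unbalanced-tabulate s) (trans (sym (lookup∘tabulate _ s)) ([]=⇒lookup s∈S)))
      (Equivalence.to (balanced⇔ (tabulate A) alt′ s) balanced))
    (λ unbal → lookup⇒[]= s _ (trans (lookup∘tabulate _ s) (¬-not λ eq →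
      unbal (Equivalence.from (balanced⇔ (tabulate A) alt′ s) (trans (unbalanced-tabulate s) eq)))))
    where
    alt′ : Alternating (lookup (tabulate A))
    alt′ = alternating-resp-≗ (sym ∘ lookup∘tabulate A) alt

    unbalanced-tabulate : ∀ s → unbalanced (lookup (tabulate A)) (corner s)
                                ≡ unbalanced A (corner s)
    unbalanced-tabulate s = cong₂ _xor_ (lookup∘tabulate A _) (lookup∘tabulate A _)

  -- Recolouring cycles and coboundaries.

  vertex-fv : ∀ x → vertex (mate f (mate v x)) ≡ vertex (mate f x)
  vertex-fv x = trans (cong vertex (fv≡vf x)) (class-step true (mate f x))

  -- Recolouring changes a square by the values of `W` at two opposite corners. The corner opposite
  -- to `y` shares a v-edge with `mate f y`, so these are the values at the two ends of the square
  -- in `graph M`.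
  imbalance-△-coboundary : ∀ A {B} W → (∀ x → B x ≡ A x xor lookup W (vertex x)) →
                           imbalance B ≡ imbalance A △ coboundary (graph M) W
  imbalance-△-coboundary A {B} W eq = subset-ext λ s →
    let y = corner s
        z = mate f (mate v y)
        w = λ x → lookup W (vertex x)
    in begin
      lookup (imbalance B) s
        ≡⟨ lookup∘tabulate _ s ⟩
      B y xor B z
        ≡⟨ cong₂ _xor_ (eq y) (eq z) ⟩
      (A y xor w y) xor (A z xor w z)
        ≡⟨ solve 4 (λ p q r t → (p :+ q) :+ (r :+ t) := (p :+ r) :+ (q :+ t)) refl
                 (A y) (w y) (A z) (w z) ⟩
      (A y xor A z) xor (w y xor w z)
        ≡⟨ cong (λ i → (A y xor A z) xor (w y xor lookup W i)) (vertex-fv y) ⟩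
      (A y xor A z) xor (w y xor w (mate f y))
        ≡⟨ cong₂ _xor_ (lookup∘tabulate _ s) (lookup∘tabulate _ s) ⟨
      lookup (imbalance A) s xor lookup (coboundary (graph M) W) s
        ≡⟨ lookup-△ (imbalance A) (coboundary (graph M) W) s ⟨
      lookup (imbalance A △ coboundary (graph M) W) s ∎
    where
    open ≡-Reasoning
    open xor-∧-Solver

  alternating-flip : ∀ {A} W → Alternating A →
                     Alternating (λ x → A x xor lookup W (vertex x))
  alternating-flip {A} W alt b x = trans
    (cong₂ _xor_ (alt b x) (cong (lookup W) (class-step b x)))
    (sym (not-distribˡ-xor (A x) _))

  -- Each step flips both colourings, so their sum is constant on the cycles of `v` and `a`; `W`
  -- records it at the representatives.
  alternating-difference : ∀ {A B} → Alternating A → Alternating B →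
    ∃ λ W → ∀ x → B x ≡ A x xor lookup W (vertex x)
  alternating-difference {A} {B} altA altB =
    tabulate (D ∘ rep-vertex) , λ x → begin
      B x
        ≡⟨ solve 2 (λ p q → q := p :+ (p :+ q)) refl (A x) (B x) ⟩
      A x xor D x
        ≡⟨ cong (A x xor_) (invariant-class D D-step x) ⟩
      A x xor D (rep-vertex (vertex x))
        ≡⟨ cong (A x xor_) (lookup∘tabulate _ (vertex x)) ⟨
      A x xor lookup (tabulate (D ∘ rep-vertex)) (vertex x) ∎
    where
    open ≡-Reasoning
    open xor-∧-Solver

    D : Fin n → Bool
    D x = A x xor B x

    D-step : ∀ b x → D (TwoMatchings.step v a b x) ≡ D x
    D-step b x = trans (cong₂ _xor_ (altA b x) (altB b x)) (xor-annihilates-not (A x) (B x))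

theorem4p3 : (M : Map) →
    ∃ λ (c : Subset (#SQ M)) →
    IsCycle (dualGraph M) c ×
    (∀ (S : Subset (#SQ M)) →
    IsImbalance M S ⇔
    (∃ λ (b : Subset (#SQ M)) → InCoboundarySpace (graph M) b × S ≡ c △ b))
-- The base cycle `c` comes from the walk-parity colouring.
theorem4p3 M = imbalance colour , imbalance-isCycle colour-alternating , λ S → mk⇔
  (λ imb → let A , alt , S≡ = isImbalance⇒ imb
               W , eq = alternating-difference colour-alternating alt
           in coboundary (graph M) W , (W , refl)
            , trans S≡ (imbalance-△-coboundary colour W eq))
  -- Given `W`, flipping that colouring on the cycles in `W` yields the required partition.
  (λ { (_ , (W , refl) , refl) →
       subst (IsImbalance M) (imbalance-△-coboundary colour W λ _ → refl)
             (⇒isImbalance (alternating-flip W colour-alternating)) })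
  where
  open Map M using (v; a)
  open Imbalances M
  open TwoMatchings v a using (colour; colour-alternating)
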